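{- In the pure Call-by-Name $\lambda$-calculus with observation $\mathrm{obs}(M)={\downarrow}\{\omega(M)\}$ (as in the context), the parallel reduction $\rightsquigarrow_{pd}$ is an $\mathrm{obs}$-normalizing (multi-step) strategy for $\to_\beta$, and for every term $M$, $M\rightsquigarrow_{pd}^{\mathrm{obs}}\mathrm{BT}(M)$.
   Context: Pure $\lambda$-terms $M::=x\mid\lambda x.M\mid MM$; $\to_\beta$ is the closure of $(\lambda x.M)N\mapsto M\{N/x\}$ under all contexts. Head reduction $\to_h$ is the closure of $\beta$ under head contexts $H::=[\,]\mid\lambda x.H\mid HM$. Parallel reduction $\rightsquigarrow_{pd}$: if $M\to_hM'$ then $M\rightsquigarrow_{pd}M'$; if $M$ is $\beta$-normal then $M\rightsquigarrow_{pd}M$; otherwise ($M$ $\to_h$-normal but not $\beta$-normal) $\lambda x.P\rightsquigarrow_{pd}\lambda x.P'$ if $P\rightsquigarrow_{pd}P'$, and $P_1P_2\rightsquigarrow_{pd}P_1'P_2'$ if $P_1\rightsquigarrow_{pd}P_1'$ and $P_2\rightsquigarrow_{pd}P_2'$. Partial terms $P::=\Omega\mid x\mid PP\mid\lambda x.P$, preordered by the least reflexive-transitive relation $\le$ with $\Omega\le P$, $P_1P_2\le P_1'P_2'$ if $P_i\le P_i'$, $\lambda x.P\le\lambda x.P'$ if $P\le P'$. $\mathrm{PNF}$: $\Omega\in\mathrm{PNF}$, and $\lambda x_1\dots x_n.xA_1\dots A_m\in\mathrm{PNF}$ if all $A_i\in\mathrm{PNF}$. $\omega(M)=\Omega$ if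 $M$ is not a head normal form (a term $\lambda\vec x.xM_1\dots M_p$), and $\omega(\lambda\vec x.xM_1\dots M_p)=\lambda\vec x.x\,\omega(M_1)\dots\omega(M_p)$. ${\downarrow}\mathcal S=\{Q\in\mathrm{PNF}\mid Q\le S\text{ for some }S\in\mathcal S\}$; $\mathrm{BT}(M)=\bigcup_{M\to_\beta^*N}{\downarrow}\{\omega(N)\}$. $\mathrm{obs}$ takes values in the ideal completion of $\mathrm{PNF}$ (ordered by inclusion, suprema of chains are unions). For a relation $R$, $M\,R^{\mathrm{obs}}\,\mathbf r$ means there is a maximal $R$-sequence $(M_n)_n$ from $M$ (infinite, or finite ending in an $R$-normal term then continued constantly) with $\bigcup_n\mathrm{obs}(M_n)=\mathbf r$; $\mathrm{Lim}(M,R)$ is the set of such $\mathbf r$. A relation $R'$ is $\mathrm{obs}$-normalizing for $R$ if it is asymptotically complete (for all $M$, $M R^{\mathrm{obs}}\mathbf q$ implies $M R'^{\mathrm{obs}}\mathbf p$ for some $\mathbf p\supseteq\mathbf q$) and asymptotically uniform (for all $M$, every element of $\mathrm{Lim}(M,R')$ is maximal in $\mathrm{Lim}(M,R')$). -}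

module Defs where

open import Data.Nat.Base using (ℕ; zero; suc)
open import Data.Product.Base using (Σ; Σ-syntax; ∃; ∃-syntax; _×_; _,_; proj₁)
open import Data.Sum.Base using (_⊎_)
open import Level using (0ℓ)
open import Relation.Binary.Core using (Rel; _⇒_)
open import Relation.Binary.Construct.Closure.ReflexiveTransitive using (Star)
open import Relation.Binary.PropositionalEquality.Core using (_≡_; refl)
open import Relation.Binary.Rewriting using (IsNormalForm)
open import Relation.Nullary using (¬_; yes; no)
open import Relation.Unary
  using (Pred; Decidable; _∈_; _⊆_; _≐_; ｛_｝; ⋃)

infix  30 _[_]
infixl 20 _·_
infixr 15 ƛ_
infix  10 _→β_ _→h_ _⇝pd_ _≤_ _≤ᴾ_

-- Terms up to α-equivalence, as de Bruijn terms; terms may be open, and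
-- dangling indices play the role of the free variables.

data Term : Set where
  var : ℕ → Term
  ƛ_  : Term → Term
  _·_ : Term → Term → Term

liftRen : (ℕ → ℕ) → (ℕ → ℕ)
liftRen ρ zero    = zero
liftRen ρ (suc x) = suc (ρ x)

rename : (ℕ → ℕ) → Term → Term
rename ρ (var x) = var (ρ x)
rename ρ (ƛ M)   = ƛ rename (liftRen ρ) M
rename ρ (M · N) = rename ρ M · rename ρ N

liftSub : (ℕ → Term) → (ℕ → Term)
liftSub σ zero    = var zero
liftSub σ (suc x) = rename suc (σ x)

subst : (ℕ → Term) → Term → Term
subst σ (var x) = σ x
subst σ (ƛ M)   = ƛ subst (liftSub σ) M
subst σ (M · N) = subst σ M · subst σ N

singleSub : Term → (ℕ → Term)
singleSub N zero    = N
singleSub N (suc x) = var x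

_[_] : Term → Term → Term
M [ N ] = subst (singleSub N) M

data _→β_ : Rel Term 0ℓ where
  β  : ∀ {M N}    → (ƛ M) · N →β M [ N ]
  ξ  : ∀ {M M′}   → M →β M′ → ƛ M →β ƛ M′
  ·ˡ : ∀ {M M′ N} → M →β M′ → M · N →β M′ · N
  ·ʳ : ∀ {M N N′} → N →β N′ → M · N →β M · N′

-- Closure of β under the head contexts H ::= [ ] | λx.H | H M.  The head of
-- an application may itself be an abstraction, so (λx.P) N can also reduce
-- inside P and →h is not deterministic.

data _→h_ : Rel Term 0ℓ where
  β  : ∀ {M N}    → (ƛ M) · N →h M [ N ]
  ξ  : ∀ {M M′}   → M →h M′ → ƛ M →h ƛ M′
  ·ˡ : ∀ {M M′ N} → M →h M′ → M · N →h M′ · N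

βNormal hNormal : Pred Term 0ℓ
βNormal = IsNormalForm _→β_
hNormal = IsNormalForm _→h_

data _⇝pd_ : Rel Term 0ℓ where
  head   : ∀ {M M′} → M →h M′ → M ⇝pd M′
  normal : ∀ {M} → βNormal M → M ⇝pd M
  lam    : ∀ {P P′} → hNormal (ƛ P) → ¬ βNormal (ƛ P) →
           P ⇝pd P′ → ƛ P ⇝pd ƛ P′
  app    : ∀ {P₁ P₁′ P₂ P₂′} → hNormal (P₁ · P₂) → ¬ βNormal (P₁ · P₂) →
           P₁ ⇝pd P₁′ → P₂ ⇝pd P₂′ → P₁ · P₂ ⇝pd P₁′ · P₂′

data Partial : Set where
  Ω   : Partial
  var : ℕ → Partial
  ƛ_  : Partial → Partial
  _·_ : Partial → Partial → Partial

data _≤_ : Rel Partial 0ℓ where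
  ≤-refl  : ∀ {P} → P ≤ P
  ≤-trans : ∀ {P Q R} → P ≤ Q → Q ≤ R → P ≤ R
  Ω≤      : ∀ {P} → Ω ≤ P
  ƛ≤      : ∀ {P P′} → P ≤ P′ → ƛ P ≤ ƛ P′
  ·≤      : ∀ {P₁ P₁′ P₂ P₂′} → P₁ ≤ P₁′ → P₂ ≤ P₂′ → P₁ · P₂ ≤ P₁′ · P₂′

-- IsSpine P     :  P = x A₁ … Aₘ          with all Aᵢ in PNF
-- IsHeadForm P  :  P = λx₁ … xₙ. x A₁ … Aₘ  with all Aᵢ in PNF
-- In particular λx.Ω is not in PNF.

data IsPNF      : Pred Partial 0ℓ
data IsHeadForm : Pred Partial 0ℓ
data IsSpine    : Pred Partial 0ℓ

data IsPNF where
  Ω    : IsPNF Ω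
  form : ∀ {P} → IsHeadForm P → IsPNF P

data IsHeadForm where
  spine : ∀ {P} → IsSpine P → IsHeadForm P
  ƛ_    : ∀ {P} → IsHeadForm P → IsHeadForm (ƛ P)

data IsSpine where
  var : ∀ x → IsSpine (var x)
  _·_ : ∀ {P A} → IsSpine P → IsPNF A → IsSpine (P · A)

PNF : Set
PNF = ∃ IsPNF

_≤ᴾ_ : Rel PNF 0ℓ
P ≤ᴾ Q = proj₁ P ≤ proj₁ Q

-- Neutral M :  M = x M₁ … Mₚ
-- HNF M     :  M = λx₁ … xₙ. x M₁ … Mₚ

data Neutral : Pred Term 0ℓ where
  var : ∀ x → Neutral (var x)
  _·_ : ∀ {M} → Neutral M → ∀ N → Neutral (M · N)

data HNF : Pred Term 0ℓ where
  neutral : ∀ {M} → Neutral M → HNF M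
  ƛ_      : ∀ {M} → HNF M → HNF (ƛ M)

neutral? : Decidable Neutral
neutral? (var x) = yes (var x)
neutral? (ƛ M)   = no λ ()
neutral? (M · N) with neutral? M
... | yes m = yes (m · N)
... | no ¬m = no λ { (m · _) → ¬m m }

hnf? : Decidable HNF
hnf? (var x) = yes (neutral (var x))
hnf? (ƛ M) with hnf? M
... | yes h = yes (ƛ h)
... | no ¬h = no λ { (ƛ h) → ¬h h }
hnf? (M · N) with neutral? (M · N)
... | yes m = yes (neutral m)
... | no ¬m = no λ { (neutral m) → ¬m m }

ω        : Term → Partial
ωHNF     : ∀ M → HNF M → Partial
ωNeutral : ∀ M → Neutral M → Partial

ω M with hnf? M
... | yes h = ωHNF M h
... | no _  = Ω

ωHNF M     (neutral m) = ωNeutral M m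
ωHNF (ƛ M) (ƛ h)       = ƛ ωHNF M h

ωNeutral (var x) (var x) = var x
ωNeutral (M · N) (m · N) = ωNeutral M m · ω N

ω-isPNF            : ∀ M → IsPNF (ω M)
ωHNF-isHeadForm    : ∀ M h → IsHeadForm (ωHNF M h)
ωNeutral-isSpine   : ∀ M m → IsSpine (ωNeutral M m)

ω-isPNF M with hnf? M
... | yes h = form (ωHNF-isHeadForm M h)
... | no _  = Ω

ωHNF-isHeadForm M     (neutral m) = spine (ωNeutral-isSpine M m)
ωHNF-isHeadForm (ƛ M) (ƛ h)       = ƛ ωHNF-isHeadForm M h

ωNeutral-isSpine (var x) (var x) = var x
ωNeutral-isSpine (M · N) (m · N) = ωNeutral-isSpine M m · ω-isPNF N

↓_ : Pred Partial 0ℓ → Pred PNF 0ℓ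
(↓ 𝒮) Q = ∃[ S ] S ∈ 𝒮 × proj₁ Q ≤ S

-- The ideal completion of PNF: inhabited, downward closed, directed subsets,
-- ordered by inclusion.

record IsIdeal (I : Pred PNF 0ℓ) : Set where
  field
    inhabited  : ∃[ P ] P ∈ I
    downClosed : ∀ {P Q} → P ≤ᴾ Q → Q ∈ I → P ∈ I
    directed   : ∀ {P Q} → P ∈ I → Q ∈ I → ∃[ U ] U ∈ I × P ≤ᴾ U × Q ≤ᴾ U

Ideal : Set₁
Ideal = Σ (Pred PNF 0ℓ) IsIdeal

elements : Ideal → Pred PNF 0ℓ
elements = proj₁

_⊑_ : Rel Ideal 0ℓ
𝐩 ⊑ 𝐪 = elements 𝐩 ⊆ elements 𝐪

↓ω-isIdeal : ∀ M → IsIdeal (↓ ｛ ω M ｝)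
↓ω-isIdeal M = record
  { inhabited  = (Ω , Ω) , ω M , refl , Ω≤
  ; downClosed = λ { P≤Q (S , eq , Q≤S) → S , eq , ≤-trans P≤Q Q≤S }
  ; directed   = λ { (_ , refl , P≤ω) (_ , refl , Q≤ω) →
                     (ω M , ω-isPNF M) , (ω M , refl , ≤-refl) , P≤ω , Q≤ω }
  }

obs : Term → Ideal
obs M = ↓ ｛ ω M ｝ , ↓ω-isIdeal M

BT : Term → Pred PNF 0ℓ
BT M = ⋃ (∃[ N ] Star _→β_ M N) λ (N , _) → ↓ ｛ ω N ｝

-- A finite maximal sequence, continued constantly after its R-normal last
-- term, and an infinite one are both covered by a sequence that at each index
-- either makes an R-step or stays at an R-normal term.

record MaximalSequence (R : Rel Term 0ℓ) (M : Term) (s : ℕ → Term) : Set where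
  field
    start : s zero ≡ M
    step  : ∀ n → R (s n) (s (suc n))
                ⊎ (IsNormalForm R (s n) × s (suc n) ≡ s n)

-- M ⟨ R ⟩ᵒᵇˢ 𝐫 is M R^obs 𝐫.

_⟨_⟩ᵒᵇˢ_ : Term → Rel Term 0ℓ → Ideal → Set
M ⟨ R ⟩ᵒᵇˢ 𝐫 =
  ∃[ s ] MaximalSequence R M s × ⋃ ℕ (λ n → elements (obs (s n))) ≐ elements 𝐫

Lim : Term → Rel Term 0ℓ → Pred Ideal 0ℓ
Lim M R 𝐫 = M ⟨ R ⟩ᵒᵇˢ 𝐫

MaximalIn : Pred Ideal 0ℓ → Ideal → Set₁
MaximalIn 𝓛 𝐩 = 𝐩 ∈ 𝓛 × (∀ 𝐪 → 𝐪 ∈ 𝓛 → 𝐩 ⊑ 𝐪 → 𝐪 ⊑ 𝐩)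

MultiStepStrategy : (R′ R : Rel Term 0ℓ) → Set
MultiStepStrategy R′ R = R′ ⇒ Star R

record ObsNormalizing (R′ R : Rel Term 0ℓ) : Set₁ where
  field
    complete : ∀ M 𝐪 → M ⟨ R ⟩ᵒᵇˢ 𝐪 → ∃[ 𝐩 ] M ⟨ R′ ⟩ᵒᵇˢ 𝐩 × 𝐪 ⊑ 𝐩
    uniform  : ∀ M 𝐩 → 𝐩 ∈ Lim M R′ → MaximalIn (Lim M R′) 𝐩

{-# OPTIONS --safe #-}

-- Loader's inductive presentation of standard reductions gives: if M →β* N and
-- N is a head normal form, then M →h* K for a head normal form K of the same
-- shape as N, whose arguments reduce to those of N.  Although →h is not
-- deterministic, its redexes lie on the spine and are neither duplicated nor
-- erased, so it has the one-step diamond property and all head reductions of M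
-- reach K after the same number of steps.  From then on ⇝pd acts on the
-- arguments in parallel.  By induction on N, some n satisfies ω(N) ≤ ω(M′) for
-- every M′ with M ⇝pdⁿ M′.  Hence every maximal ⇝pd-sequence from M computes
-- BT(M), and in particular BT(M) is directed.

module Submission where

open import Defs
open import Data.Nat.Base using (ℕ; zero; suc; _+_)
open import Data.Nat.Properties using (+-comm)
open import Data.Product using (_×_; _,_; Σ-syntax; ∃; ∃-syntax; proj₁; proj₂)
open import Data.Sum.Base using (_⊎_; inj₁; inj₂)
open import Function.Base using (_∘_; id)
open import Level using (0ℓ)
open import Relation.Binary.Core using (Rel; _⇒_)
open import Relation.Binary.Construct.Closure.ReflexiveTransitive
  using (Star; ε; _◅_; _◅◅_; gmap; return)
open import Relation.Binary.PropositionalEquality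
  using (_≡_; _≗_; refl; sym; trans; cong; cong₂; module ≡-Reasoning)
open import Relation.Nullary using (¬_; Dec; yes; no; contradiction)
open import Relation.Unary using (Pred; _⊆_; _≐_; ⋃)

-- Substitution

liftRen-cong : ∀ {ρ ρ′} → ρ ≗ ρ′ → liftRen ρ ≗ liftRen ρ′
liftRen-cong e zero    = refl
liftRen-cong e (suc x) = cong suc (e x)

rename-cong : ∀ {ρ ρ′} → ρ ≗ ρ′ → rename ρ ≗ rename ρ′
rename-cong e (var x) = cong var (e x)
rename-cong e (ƛ M)   = cong ƛ_ (rename-cong (liftRen-cong e) M)
rename-cong e (M · N) = cong₂ _·_ (rename-cong e M) (rename-cong e N)

liftSub-cong : ∀ {σ σ′} → σ ≗ σ′ → liftSub σ ≗ liftSub σ′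
liftSub-cong e zero    = refl
liftSub-cong e (suc x) = cong (rename suc) (e x)

subst-cong : ∀ {σ σ′} → σ ≗ σ′ → subst σ ≗ subst σ′
subst-cong e (var x) = e x
subst-cong e (ƛ M)   = cong ƛ_ (subst-cong (liftSub-cong e) M)
subst-cong e (M · N) = cong₂ _·_ (subst-cong e M) (subst-cong e N)

liftSub-var : ∀ ρ → liftSub (var ∘ ρ) ≗ var ∘ liftRen ρ
liftSub-var ρ zero    = refl
liftSub-var ρ (suc x) = refl

subst-var∘ : ∀ ρ → subst (var ∘ ρ) ≗ rename ρ
subst-var∘ ρ (var x) = refl
subst-var∘ ρ (ƛ M)   =
  cong ƛ_ (trans (subst-cong (liftSub-var ρ) M) (subst-var∘ (liftRen ρ) M))
subst-var∘ ρ (M · N) = cong₂ _·_ (subst-var∘ ρ M) (subst-var∘ ρ N)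

liftSub-id : liftSub var ≗ var
liftSub-id zero    = refl
liftSub-id (suc x) = refl

subst-id : subst var ≗ id
subst-id (var x) = refl
subst-id (ƛ M)   = cong ƛ_ (trans (subst-cong liftSub-id M) (subst-id M))
subst-id (M · N) = cong₂ _·_ (subst-id M) (subst-id N)

liftSub-liftRen : ∀ σ ρ → liftSub σ ∘ liftRen ρ ≗ liftSub (σ ∘ ρ)
liftSub-liftRen σ ρ zero    = refl
liftSub-liftRen σ ρ (suc x) = refl

subst-rename : ∀ σ ρ → subst σ ∘ rename ρ ≗ subst (σ ∘ ρ)
subst-rename σ ρ (var x) = refl
subst-rename σ ρ (ƛ M)   =
  cong ƛ_ (trans (subst-rename (liftSub σ) (liftRen ρ) M)
                 (subst-cong (liftSub-liftRen σ ρ) M))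
subst-rename σ ρ (M · N) = cong₂ _·_ (subst-rename σ ρ M) (subst-rename σ ρ N)

-- Reading the outer renaming as a substitution of variables lets `subst-rename` fuse both sides
-- into one and the same substitution.
rename-suc-comm : ∀ ρ → rename (liftRen ρ) ∘ rename suc ≗ rename suc ∘ rename ρ
rename-suc-comm ρ M = begin
  rename (liftRen ρ) (rename suc M)           ≡⟨ subst-var∘ (liftRen ρ) (rename suc M) ⟨
  subst (var ∘ liftRen ρ) (rename suc M)      ≡⟨ subst-rename (var ∘ liftRen ρ) suc M ⟩
  subst (λ x → var (suc (ρ x))) M             ≡⟨ subst-rename (λ x → var (suc x)) ρ M ⟨
  subst (λ x → var (suc x)) (rename ρ M)      ≡⟨ subst-var∘ suc (rename ρ M) ⟩
  rename suc (rename ρ M)                     ∎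
  where open ≡-Reasoning

liftRen-liftSub : ∀ ρ σ → rename (liftRen ρ) ∘ liftSub σ ≗ liftSub (rename ρ ∘ σ)
liftRen-liftSub ρ σ zero    = refl
liftRen-liftSub ρ σ (suc x) = rename-suc-comm ρ (σ x)

rename-subst : ∀ ρ σ → rename ρ ∘ subst σ ≗ subst (rename ρ ∘ σ)
rename-subst ρ σ (var x) = refl
rename-subst ρ σ (ƛ M)   =
  cong ƛ_ (trans (rename-subst (liftRen ρ) (liftSub σ) M)
                 (subst-cong (liftRen-liftSub ρ σ) M))
rename-subst ρ σ (M · N) = cong₂ _·_ (rename-subst ρ σ M) (rename-subst ρ σ N)

liftSub-∘ : ∀ τ σ → subst (liftSub τ) ∘ liftSub σ ≗ liftSub (subst τ ∘ σ)
liftSub-∘ τ σ zero    = refl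
liftSub-∘ τ σ (suc x) =
  trans (subst-rename (liftSub τ) suc (σ x)) (sym (rename-subst suc τ (σ x)))

subst-subst : ∀ τ σ → subst τ ∘ subst σ ≗ subst (subst τ ∘ σ)
subst-subst τ σ (var x) = refl
subst-subst τ σ (ƛ M)   =
  cong ƛ_ (trans (subst-subst (liftSub τ) (liftSub σ) M)
                 (subst-cong (liftSub-∘ τ σ) M))
subst-subst τ σ (M · N) = cong₂ _·_ (subst-subst τ σ M) (subst-subst τ σ N)

subst-[] : ∀ σ M N → subst σ (M [ N ]) ≡ subst (liftSub σ) M [ subst σ N ]
subst-[] σ M N = begin
  subst σ (M [ N ])                                          ≡⟨ subst-subst σ (singleSub N) M ⟩
  subst (subst σ ∘ singleSub N) M                            ≡⟨ subst-cong eq M ⟩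
  subst (subst (singleSub (subst σ N)) ∘ liftSub σ) M        ≡⟨ subst-subst (singleSub (subst σ N)) (liftSub σ) M ⟨
  subst (liftSub σ) M [ subst σ N ]                          ∎
  where
  open ≡-Reasoning
  eq : subst σ ∘ singleSub N ≗ subst (singleSub (subst σ N)) ∘ liftSub σ
  eq zero    = refl
  eq (suc x) = sym (trans (subst-rename (singleSub (subst σ N)) suc (σ x)) (subst-id (σ x)))

-- Head reduction

infix 10 _→h*_

_→h*_ : Rel Term 0ℓ
_→h*_ = Star _→h_

→h⇒→β : _→h_ ⇒ _→β_
→h⇒→β β      = β
→h⇒→β (ξ r)  = ξ (→h⇒→β r)
→h⇒→β (·ˡ r) = ·ˡ (→h⇒→β r)

→h-subst : ∀ σ {M M′} → M →h M′ → subst σ M →h subst σ M′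
→h-subst σ (β {M} {N}) rewrite subst-[] σ M N = β
→h-subst σ (ξ r)  = ξ (→h-subst (liftSub σ) r)
→h-subst σ (·ˡ r) = ·ˡ (→h-subst σ r)

→h-rename : ∀ ρ {M M′} → M →h M′ → rename ρ M →h rename ρ M′
→h-rename ρ {M} {M′} r
  rewrite sym (subst-var∘ ρ M) | sym (subst-var∘ ρ M′) = →h-subst (var ∘ ρ) r

-- The only overlap is `(ƛ M) · N` against a step inside `M`. That step survives the substitution of
-- `N` by `→h-subst`, and since no head redex is copied or erased, one step closes each side.
→h-diamond : ∀ {M M₁ M₂} → M →h M₁ → M →h M₂ →
             M₁ ≡ M₂ ⊎ (∃[ M₃ ] M₁ →h M₃ × M₂ →h M₃)
→h-diamond β β           = inj₁ refl
→h-diamond β (·ˡ (ξ r))  = inj₂ (_ , →h-subst _ r , β)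
→h-diamond (·ˡ (ξ r)) β  = inj₂ (_ , β , →h-subst _ r)
→h-diamond (ξ r) (ξ r′) with →h-diamond r r′
... | inj₁ refl          = inj₁ refl
... | inj₂ (_ , q , q′)  = inj₂ (_ , ξ q , ξ q′)
→h-diamond (·ˡ r) (·ˡ r′) with →h-diamond r r′
... | inj₁ refl          = inj₁ refl
... | inj₂ (_ , q , q′)  = inj₂ (_ , ·ˡ q , ·ˡ q′)

neutral-¬→h : ∀ {M M′} → Neutral M → ¬ M →h M′
neutral-¬→h (m · _) (·ˡ r) = neutral-¬→h m r

HNF⇒hNormal : ∀ {M} → HNF M → hNormal M
HNF⇒hNormal (neutral m) (_ , r)   = neutral-¬→h m r
HNF⇒hNormal (ƛ h)       (_ , ξ r) = HNF⇒hNormal h (_ , r)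

head-progress : ∀ M → HNF M ⊎ ∃ (M →h_)
head-progress (var x) = inj₁ (neutral (var x))
head-progress (ƛ M) with head-progress M
... | inj₁ h       = inj₁ (ƛ h)
... | inj₂ (_ , r) = inj₂ (_ , ξ r)
head-progress (M · N) with head-progress M
... | inj₁ (neutral m) = inj₁ (neutral (m · N))
... | inj₁ (ƛ h)       = inj₂ (_ , β)
... | inj₂ (_ , r)     = inj₂ (_ , ·ˡ r)

βNormal⇒hNormal : ∀ {M} → βNormal M → hNormal M
βNormal⇒hNormal n (_ , r) = n (_ , →h⇒→β r)

-- Standard reductions

-- Head steps first expose the root of the target; the reduction then continues independently in the
-- immediate subterms.
data Standard : Rel Term 0ℓ where
  var : ∀ {M x} → M →h* var x → Standard M (var x)
  lam : ∀ {M P N} → M →h* ƛ P → Standard P N → Standard M (ƛ N)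
  app : ∀ {M P₁ P₂ N₁ N₂} → M →h* P₁ · P₂ →
        Standard P₁ N₁ → Standard P₂ N₂ → Standard M (N₁ · N₂)

standard-refl : ∀ M → Standard M M
standard-refl (var x) = var ε
standard-refl (ƛ M)   = lam ε (standard-refl M)
standard-refl (M · N) = app ε (standard-refl M) (standard-refl N)

→h*-standard : ∀ {L M N} → L →h* M → Standard M N → Standard L N
→h*-standard q (var r)     = var (q ◅◅ r)
→h*-standard q (lam r s)   = lam (q ◅◅ r) s
→h*-standard q (app r s t) = app (q ◅◅ r) s t

standard-rename : ∀ ρ {M N} → Standard M N → Standard (rename ρ M) (rename ρ N)
standard-rename ρ (var r)     = var (gmap (rename ρ) (→h-rename ρ) r)
standard-rename ρ (lam r s)   =
  lam (gmap (rename ρ) (→h-rename ρ) r) (standard-rename (liftRen ρ) s)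
standard-rename ρ (app r s t) =
  app (gmap (rename ρ) (→h-rename ρ) r) (standard-rename ρ s) (standard-rename ρ t)

standard-liftSub : ∀ {σ τ} → (∀ x → Standard (σ x) (τ x)) →
                   ∀ x → Standard (liftSub σ x) (liftSub τ x)
standard-liftSub σ∼τ zero    = var ε
standard-liftSub σ∼τ (suc x) = standard-rename suc (σ∼τ x)

standard-subst : ∀ {σ τ M N} → (∀ x → Standard (σ x) (τ x)) →
                 Standard M N → Standard (subst σ M) (subst τ N)
standard-subst {σ} σ∼τ (var {x = x} r) =
  →h*-standard (gmap (subst σ) (→h-subst σ) r) (σ∼τ x)
standard-subst {σ} σ∼τ (lam r s)       =
  lam (gmap (subst σ) (→h-subst σ) r) (standard-subst (standard-liftSub σ∼τ) s)
standard-subst {σ} σ∼τ (app r s t)     =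
  app (gmap (subst σ) (→h-subst σ) r) (standard-subst σ∼τ s) (standard-subst σ∼τ t)

standard-[] : ∀ {M M′ N N′} → Standard M M′ → Standard N N′ →
              Standard (M [ N ]) (M′ [ N′ ])
standard-[] s t = standard-subst (λ { zero → t ; (suc x) → var ε }) s

-- A redex of the target stems from an application and an abstraction that head steps have exposed,
-- so it can be contracted by a head step already on the way from `M`; `standard-[]` merges what is
-- left.
standard-→β : ∀ {M N N′} → Standard M N → N →β N′ → Standard M N′
standard-→β (app r (lam q s) t) β =
  →h*-standard (r ◅◅ gmap (_· _) ·ˡ q ◅◅ return β) (standard-[] s t)
standard-→β (lam r s)   (ξ p)  = lam r (standard-→β s p)
standard-→β (app r s t) (·ˡ p) = app r (standard-→β s p) t
standard-→β (app r s t) (·ʳ p) = app r s (standard-→β t p)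

standardization : Star _→β_ ⇒ Standard
standardization {M} = go (standard-refl M)
  where
  go : ∀ {N N′} → Standard M N → Star _→β_ N N′ → Standard M N′
  go s ε        = s
  go s (r ◅ rs) = go (standard-→β s r) rs

-- The partial normal form ω

-- `ω` computes from the proof returned by `hnf?`; irrelevance allows any other proof to be used in
-- its place.
neutral-irrelevant : ∀ {M} (m m′ : Neutral M) → m ≡ m′
neutral-irrelevant (var x) (var .x)  = refl
neutral-irrelevant (m · N) (m′ · .N) = cong (_· N) (neutral-irrelevant m m′)

HNF-irrelevant : ∀ {M} (h h′ : HNF M) → h ≡ h′
HNF-irrelevant (neutral m) (neutral m′) = cong neutral (neutral-irrelevant m m′)
HNF-irrelevant (ƛ h)       (ƛ h′)       = cong ƛ_ (HNF-irrelevant h h′)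

ω-HNF : ∀ {M} (h : HNF M) → ω M ≡ ωHNF M h
ω-HNF {M} h with hnf? M
... | yes h′ = cong (ωHNF M) (HNF-irrelevant h′ h)
... | no ¬h  = contradiction h ¬h

ω-¬HNF : ∀ {M} → ¬ HNF M → ω M ≡ Ω
ω-¬HNF {M} ¬h with hnf? M
... | yes h = contradiction h ¬h
... | no _  = refl

ω-ƛ : ∀ {M} → HNF M → ω (ƛ M) ≡ ƛ ω M
ω-ƛ h = trans (ω-HNF (ƛ h)) (cong ƛ_ (sym (ω-HNF h)))

ω-· : ∀ {M} → Neutral M → ∀ N → ω (M · N) ≡ ω M · ω N
ω-· m N = trans (ω-HNF (neutral (m · N))) (cong (_· ω N) (sym (ω-HNF (neutral m))))

-- The strategy ⇝pd

β-progress? : ∀ M → Dec (∃ (M →β_))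
β-progress? (var x) = no λ ()
β-progress? (ƛ M) with β-progress? M
... | yes (_ , r) = yes (_ , ξ r)
... | no ¬r       = no λ { (_ , ξ r) → ¬r (_ , r) }
β-progress? (M · N) with head-progress (M · N) | β-progress? M | β-progress? N
... | inj₂ (_ , r) | _           | _           = yes (_ , →h⇒→β r)
... | inj₁ _       | yes (_ , r) | _           = yes (_ , ·ˡ r)
... | inj₁ _       | no _        | yes (_ , r) = yes (_ , ·ʳ r)
... | inj₁ (neutral (m · _)) | no ¬l | no ¬r   =
  no λ { (_ , β) → contradiction m λ () ; (_ , ·ˡ r) → ¬l (_ , r) ; (_ , ·ʳ r) → ¬r (_ , r) }

-- A β-normal term steps to itself, so `⇝pd` has no normal forms and its maximal sequences step at
-- every index.
⇝pd-total : ∀ M → ∃ (M ⇝pd_)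
⇝pd-total M with head-progress M
... | inj₂ (_ , r) = _ , head r
... | inj₁ h       = go M h
  where
  go : ∀ M → HNF M → ∃ (M ⇝pd_)
  go M h with β-progress? M
  ... | no ¬r = _ , normal ¬r
  go (var x)  h | yes (_ , ())
  go (ƛ M)    h | yes r = _ , lam (HNF⇒hNormal h) (λ n → n r) (proj₂ (⇝pd-total M))
  go (M · N)  h | yes r =
    _ , app (HNF⇒hNormal h) (λ n → n r) (proj₂ (⇝pd-total M)) (proj₂ (⇝pd-total N))

⇝pd⇒→β* : _⇝pd_ ⇒ Star _→β_
⇝pd⇒→β* (head r)      = return (→h⇒→β r)
⇝pd⇒→β* (normal _)    = ε
⇝pd⇒→β* (lam _ _ p)   = gmap ƛ_ ξ (⇝pd⇒→β* p)
⇝pd⇒→β* (app _ _ p q) = gmap (_· _) ·ˡ (⇝pd⇒→β* p) ◅◅ gmap (_ ·_) ·ʳ (⇝pd⇒→β* q)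

⇝pd-neutral : ∀ {M M′} → Neutral M → M ⇝pd M′ → Neutral M′
⇝pd-neutral m       (head r)      = contradiction r (neutral-¬→h m)
⇝pd-neutral m       (normal _)    = m
⇝pd-neutral (m · _) (app _ _ p _) = ⇝pd-neutral m p · _

⇝pd-HNF : ∀ {M M′} → HNF M → M ⇝pd M′ → HNF M′
⇝pd-HNF (neutral m) p           = neutral (⇝pd-neutral m p)
⇝pd-HNF (ƛ h)       (head r)    = contradiction (_ , r) (HNF⇒hNormal (ƛ h))
⇝pd-HNF (ƛ h)       (normal _)  = ƛ h
⇝pd-HNF (ƛ h)       (lam _ _ p) = ƛ ⇝pd-HNF h p

-- The rule `normal` acts componentwise too, since the body of a β-normal abstraction is β-normal
-- and steps to itself; `⇝pd-·` treats neutral applications likewise.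
⇝pd-ƛ : ∀ {M T} → HNF M → ƛ M ⇝pd T → ∃[ M′ ] T ≡ ƛ M′ × M ⇝pd M′
⇝pd-ƛ h (head r)    = contradiction (_ , r) (HNF⇒hNormal (ƛ h))
⇝pd-ƛ h (normal n)  = _ , refl , normal λ { (_ , r) → n (_ , ξ r) }
⇝pd-ƛ h (lam _ _ p) = _ , refl , p

⇝pd-· : ∀ {M N T} → Neutral M → M · N ⇝pd T →
        ∃[ M′ ] ∃[ N′ ] T ≡ M′ · N′ × M ⇝pd M′ × N ⇝pd N′
⇝pd-· m (head r)      = contradiction r (neutral-¬→h (m · _))
⇝pd-· m (normal n)    = _ , _ , refl , normal (λ { (_ , r) → n (_ , ·ˡ r) })
                                     , normal (λ { (_ , r) → n (_ , ·ʳ r) })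
⇝pd-· m (app _ _ p q) = _ , _ , refl , p , q

-- A step from a head normal form keeps its abstractions and head variable and acts only on the
-- arguments; on all other terms `ω` is `Ω`.
ω-mono : ∀ {M M′} → M ⇝pd M′ → ω M ≤ ω M′
ω-mono {M} p with head-progress M
ω-mono {M} (head r) | inj₁ h = contradiction (_ , r) (HNF⇒hNormal h)
ω-mono {M} (normal _) | _ = ≤-refl
ω-mono (lam _ _ p) | inj₁ (ƛ h)
  rewrite ω-ƛ h | ω-ƛ (⇝pd-HNF h p) = ƛ≤ (ω-mono p)
ω-mono (app {P₂′ = N′} _ _ p q) | inj₁ (neutral (m · N))
  rewrite ω-· m N | ω-· (⇝pd-neutral m p) N′ = ·≤ (ω-mono p) (ω-mono q)
ω-mono {M} p | inj₂ r rewrite ω-¬HNF {M} (λ h → HNF⇒hNormal h r) = Ω≤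

-- Iterated steps

infixr 5 _∷_

-- The length is an index because comparing head reductions with `⇝pd` relies on exact step counts.
data Iter (R : Rel Term 0ℓ) : ℕ → Rel Term 0ℓ where
  []  : ∀ {M} → Iter R zero M M
  _∷_ : ∀ {n L M N} → R L M → Iter R n M N → Iter R (suc n) L N

Iter-split : ∀ {R} m {n L N} → Iter R (m + n) L N →
             ∃[ M ] Iter R m L M × Iter R n M N
Iter-split zero    ps       = _ , [] , ps
Iter-split (suc m) (p ∷ ps) =
  let _ , qs , rs = Iter-split m ps in _ , p ∷ qs , rs

Star⇒Iter : ∀ {R M N} → Star R M N → ∃[ n ] Iter R n M N
Star⇒Iter ε        = _ , []
Star⇒Iter (r ◅ rs) = _ , r ∷ proj₂ (Star⇒Iter rs)

Iter⇒Star : ∀ {R S : Rel Term 0ℓ} {n} → R ⇒ Star S → Iter R n ⇒ Star S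
Iter⇒Star f []       = ε
Iter⇒Star f (r ∷ rs) = f r ◅◅ Iter⇒Star f rs

sequence⇒Iter : ∀ {R : Rel Term 0ℓ} (s : ℕ → Term) →
                (∀ n → R (s n) (s (suc n))) → ∀ n → Iter R n (s 0) (s n)
sequence⇒Iter s step zero    = []
sequence⇒Iter s step (suc n) = step 0 ∷ sequence⇒Iter (s ∘ suc) (step ∘ suc) n

Iter-ω-mono : ∀ {n M M′} → Iter _⇝pd_ n M M′ → ω M ≤ ω M′
Iter-ω-mono []       = ≤-refl
Iter-ω-mono (p ∷ ps) = ≤-trans (ω-mono p) (Iter-ω-mono ps)

Iter-ƛ : ∀ {n M T} → HNF M → Iter _⇝pd_ n (ƛ M) T →
         ∃[ M′ ] T ≡ ƛ M′ × HNF M′ × Iter _⇝pd_ n M M′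
Iter-ƛ h []       = _ , refl , h , []
Iter-ƛ h (p ∷ ps) with ⇝pd-ƛ h p
... | _ , refl , q with Iter-ƛ (⇝pd-HNF h q) ps
... | _ , refl , h′ , qs = _ , refl , h′ , q ∷ qs

Iter-· : ∀ {n M N T} → Neutral M → Iter _⇝pd_ n (M · N) T →
         ∃[ M′ ] ∃[ N′ ] T ≡ M′ · N′ × Neutral M′ ×
         Iter _⇝pd_ n M M′ × Iter _⇝pd_ n N N′
Iter-· m []       = _ , _ , refl , m , [] , []
Iter-· m (p ∷ ps) with ⇝pd-· m p
... | _ , _ , refl , q , r with Iter-· (⇝pd-neutral m q) ps
... | _ , _ , refl , m′ , qs , rs = _ , _ , refl , m′ , q ∷ qs , r ∷ rs

-- By the diamond, any head step can open a reduction to `K` without changing its total length.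
→h-follows : ∀ {k M M′ K} → HNF K → Iter _→h_ (suc k) M K → M →h M′ →
             Iter _→h_ k M′ K
→h-follows h (r ∷ rs) r′ with →h-diamond r r′
→h-follows h (r ∷ rs) r′       | inj₁ refl        = rs
-- Closing the diamond here would give `K` itself a head reduct.
→h-follows h (r ∷ [])       r′ | inj₂ (_ , q , _) =
  contradiction (_ , q) (HNF⇒hNormal h)
→h-follows h (r ∷ rs@(_ ∷ _)) r′ | inj₂ (_ , q , q′) = q′ ∷ →h-follows h rs q

⇝pd-reducible : ∀ {M M′ M″} → M →h M′ → M ⇝pd M″ → M →h M″
⇝pd-reducible r (head r′)     = r′
⇝pd-reducible r (normal n)    = contradiction (_ , r) (βNormal⇒hNormal n)
⇝pd-reducible r (lam n _ _)   = contradiction (_ , r) n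
⇝pd-reducible r (app n _ _ _) = contradiction (_ , r) n

-- Until `K` is reached a head redex remains, so `⇝pd` must take a head step, and by `→h-follows`
-- each such step lowers the distance to `K` by one.
⇝pd-reaches-HNF : ∀ {k M M′ K} → HNF K → Iter _→h_ k M K → Iter _⇝pd_ k M M′ →
                  M′ ≡ K
⇝pd-reaches-HNF h []          []       = refl
⇝pd-reaches-HNF h rs@(r ∷ _) (p ∷ ps) =
  ⇝pd-reaches-HNF h (→h-follows h rs (⇝pd-reducible r p)) ps

-- Approximations reached by ⇝pd

-- The bound `n` is uniform over all `⇝pd`-reductions from `M`, as `⇝pd` inherits the nondeterminism
-- of `→h`.
Reaches : Term → Partial → Set
Reaches M Q = ∃[ n ] (∀ {M′} → Iter _⇝pd_ n M M′ → Q ≤ ω M′)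

reaches-Ω : ∀ {M} → Reaches M Ω
reaches-Ω = 0 , λ _ → Ω≤

reaches-ω : ∀ {M} → Reaches M (ω M)
reaches-ω = 0 , Iter-ω-mono

reaches-ƛ : ∀ {M Q} → HNF M → Reaches M Q → Reaches (ƛ M) (ƛ Q)
reaches-ƛ {Q = Q} h (n , f) = n , g
  where
  g : ∀ {T} → Iter _⇝pd_ n (ƛ _) T → ƛ Q ≤ ω T
  g ps with Iter-ƛ h ps
  ... | _ , refl , h′ , qs rewrite ω-ƛ h′ = ƛ≤ (f qs)

-- Function and argument evolve in parallel, so `a + b` steps are enough for both; by `Iter-ω-mono`
-- the surplus steps lose nothing.
reaches-· : ∀ {M N P Q} → Neutral M → Reaches M P → Reaches N Q →
            Reaches (M · N) (P · Q)
reaches-· {M} {N} {P} {Q} m (a , f) (b , g) = a + b , k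
  where
  k : ∀ {T} → Iter _⇝pd_ (a + b) (M · N) T → P · Q ≤ ω T
  k ps with Iter-· m ps
  -- The sum is commuted to split `b` steps off the argument's reduction, then commuted back to
  -- split `a` steps off the function's.
  ... | _ , N′ , refl , m′ , qs , rs rewrite ω-· m′ N′ | +-comm a b
    with Iter-split b rs
  ... | _ , rs₁ , rs₂ rewrite +-comm b a with Iter-split a qs
  ... | _ , qs₁ , qs₂ = ·≤ (≤-trans (f qs₁) (Iter-ω-mono qs₂))
                           (≤-trans (g rs₁) (Iter-ω-mono rs₂))

reaches-→h* : ∀ {M K Q} → M →h* K → HNF K → Reaches K Q → Reaches M Q
reaches-→h* {M} {Q = Q} rs h (n , f) = k + n , g
  where
  k = proj₁ (Star⇒Iter rs)
  g : ∀ {M′} → Iter _⇝pd_ (k + n) M M′ → Q ≤ ω M′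
  g ps with Iter-split k ps
  ... | _ , qs , qs′ with ⇝pd-reaches-HNF h (proj₂ (Star⇒Iter rs)) qs
  ... | refl = f qs′

-- Mutual induction on the standard reduction. Head steps expose the spine of `N` one application at
-- a time, leaving the arguments of `K` untouched; `standard-reaches` then treats each argument as a
-- new source.
standard-neutral : ∀ {M N} → Standard M N → Neutral N →
                   ∃[ K ] M →h* K × Neutral K × Reaches K (ω N)
standard-HNF     : ∀ {M N} → Standard M N → HNF N →
                   ∃[ K ] M →h* K × HNF K × Reaches K (ω N)
standard-reaches : ∀ {M N} → Standard M N → Reaches M (ω N)

standard-neutral (var r)     (var x) = _ , r , var x , reaches-ω
standard-neutral (app r s t) (m · N) rewrite ω-· m N =
  let _ , q , k , reach = standard-neutral s m
  in  _ , r ◅◅ gmap (_· _) ·ˡ q , k · _ , reaches-· k reach (standard-reaches t)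

standard-HNF s         (neutral m) =
  let _ , r , k , reach = standard-neutral s m in _ , r , neutral k , reach
standard-HNF (lam r s) (ƛ h) rewrite ω-ƛ h =
  let _ , q , k , reach = standard-HNF s h
  in  _ , r ◅◅ gmap ƛ_ ξ q , ƛ k , reaches-ƛ k reach

standard-reaches {N = N} s with head-progress N
... | inj₁ h = let _ , r , k , reach = standard-HNF s h in reaches-→h* r k reach
... | inj₂ r rewrite ω-¬HNF {N} (λ h → HNF⇒hNormal h r) = reaches-Ω

-- Böhm trees

limit : (ℕ → Term) → Pred PNF 0ℓ
limit s = ⋃ ℕ λ n → elements (obs (s n))

limit⊆BT : ∀ {M} s → (∀ n → Star _→β_ M (s n)) → limit s ⊆ BT M
limit⊆BT s M→s (n , S , eq , Q≤S) = (s n , M→s n) , S , eq , Q≤S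

module _ {M : Term} {s : ℕ → Term} (max : MaximalSequence _⇝pd_ M s) where
  open MaximalSequence max

  ⇝pd-step : ∀ n → s n ⇝pd s (suc n)
  ⇝pd-step n with step n
  ... | inj₁ p       = p
  ... | inj₂ (n , _) = contradiction (⇝pd-total _) n

  -- Standardization turns each reduct `N` of `M` into a bound that holds for every `⇝pd`-sequence,
  -- so the limit does not depend on the choice of `s`.
  ⇝pd-limit : limit s ≐ BT M
  ⇝pd-limit with start
  ... | refl =
    (λ {Q} → limit⊆BT s (λ n → Iter⇒Star ⇝pd⇒→β* (iter n)) {Q}) , λ {Q} → BT⊆limit {Q}
    where
    iter = sequence⇒Iter s ⇝pd-step
    BT⊆limit : BT M ⊆ limit s
    BT⊆limit ((N , r) , _ , refl , Q≤ω) =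
      let n , f = standard-reaches (standardization r)
      in  n , ω (s n) , refl , ≤-trans Q≤ω (f (iter n))

-- Equality can fail: an infinite β-sequence may neglect a redex forever and compute less than
-- `BT M`.
→β-limit⊆BT : ∀ {M s} → MaximalSequence _→β_ M s → limit s ⊆ BT M
→β-limit⊆BT {M} {s} max {Q} with MaximalSequence.start max
... | refl = limit⊆BT s reach {Q}
  where
  reach : ∀ n → Star _→β_ (s 0) (s n)
  reach zero    = ε
  reach (suc n) with MaximalSequence.step max n
  ... | inj₁ r        = reach n ◅◅ return r
  ... | inj₂ (_ , eq) rewrite eq = reach n

pdSequence : Term → ℕ → Term
pdSequence M zero    = M
pdSequence M (suc n) = proj₁ (⇝pd-total (pdSequence M n))

pdSequence-maximal : ∀ M → MaximalSequence _⇝pd_ M (pdSequence M)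
pdSequence-maximal M = record
  { start = refl
  ; step  = λ n → inj₁ (proj₂ (⇝pd-total (pdSequence M n)))
  }

-- Directed because it is the limit of the increasing sequence of the ω (s n),
-- for s the ⇝pd-sequence from M; no confluence argument is needed.
BT-isIdeal : ∀ M → IsIdeal (BT M)
BT-isIdeal M = record
  { inhabited  = (Ω , Ω) , (M , ε) , ω M , refl , Ω≤
  ; downClosed = λ { P≤Q (N , S , eq , Q≤S) → N , S , eq , ≤-trans P≤Q Q≤S }
  ; directed   = λ {P} {Q} P∈ Q∈ → dir {P} {Q} (BT⊆limit {P} P∈) (BT⊆limit {Q} Q∈)
  }
  where
  s = pdSequence M
  limit⊆ : limit s ⊆ BT M
  limit⊆ {Q} = proj₁ (⇝pd-limit (pdSequence-maximal M)) {Q}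
  BT⊆limit : BT M ⊆ limit s
  BT⊆limit {Q} = proj₂ (⇝pd-limit (pdSequence-maximal M)) {Q}
  ω-mono-+ : ∀ m n → ω (s n) ≤ ω (s (m + n))
  ω-mono-+ zero    n = ≤-refl
  ω-mono-+ (suc m) n =
    ≤-trans (ω-mono-+ m n) (ω-mono (⇝pd-step (pdSequence-maximal M) (m + n)))
  dir : ∀ {P Q} → limit s P → limit s Q →
        ∃[ U ] BT M U × P ≤ᴾ U × Q ≤ᴾ U
  dir (m , _ , refl , P≤) (n , _ , refl , Q≤) =
    U , limit⊆ {U} (m + n , _ , refl , ≤-refl) ,
    ≤-trans P≤ P≤′ , ≤-trans Q≤ (ω-mono-+ m n)
    where
    U : PNF
    U = ω (s (m + n)) , ω-isPNF (s (m + n))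
    P≤′ : ω (s m) ≤ ω (s (m + n))
    P≤′ rewrite +-comm m n = ω-mono-+ n m

⇝pd-BT : ∀ M → M ⟨ _⇝pd_ ⟩ᵒᵇˢ (BT M , BT-isIdeal M)
⇝pd-BT M = pdSequence M , pdSequence-maximal M , ⇝pd-limit (pdSequence-maximal M)

⇝pd-obsNormalizing : ObsNormalizing _⇝pd_ _→β_
⇝pd-obsNormalizing = record
  { complete = λ { M 𝐪 (s , max , _ , 𝐪⊆) →
      (BT M , BT-isIdeal M) , ⇝pd-BT M ,
      λ {P} P∈𝐪 → →β-limit⊆BT max {P} (𝐪⊆ {P} P∈𝐪) }
  -- Both limits equal `BT M`, so maximality holds because there is only one limit up to equality of
  -- elements.
  ; uniform  = λ { M 𝐩 𝐩∈@(_ , max , ⊆𝐩 , _) → 𝐩∈ ,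
      λ { 𝐪 (_ , max′ , _ , 𝐪⊆) _ {P} P∈𝐪 →
        ⊆𝐩 {P} (proj₂ (⇝pd-limit max) {P} (proj₁ (⇝pd-limit max′) {P} (𝐪⊆ {P} P∈𝐪))) } }
  }

mainTheorem18 : MultiStepStrategy _⇝pd_ _→β_
    × ObsNormalizing _⇝pd_ _→β_
    × (∀ M → Σ[ ideal ∈ IsIdeal (BT M) ] (M ⟨ _⇝pd_ ⟩ᵒᵇˢ (BT M , ideal)))
mainTheorem18 = ⇝pd⇒→β* , ⇝pd-obsNormalizing , λ M → BT-isIdeal M , ⇝pd-BT M
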